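{- For every integer $d\ge 1$, there is a finite poset $P$ such that $\operatorname{ldim}(P)=d$ while $\operatorname{ldim}(B)\le 3$ for every block $B$ of $P$.
   Context: All posets are finite. A partial linear extension (ple) of a poset $P$ is a linear extension of a subposet of $P$. For a family $\mathcal{L}$ of ple's of $P$ and $u\in P$, let $\mu(u,\mathcal{L})=|\{L\in\mathcal{L}: u\in L\}|$ and $\mu(P,\mathcal{L})=\max_{u\in P}\mu(u,\mathcal{L})$. A family $\mathcal{L}$ of ple's of $P$ is a local realizer of $P$ if (1) whenever $x<y$ in $P$ there is $L\in\mathcal{L}$ with $x<y$ in $L$, and (2) whenever $x$ and $y$ are incomparable in $P$ there is $L\in\mathcal{L}$ with $x>y$ in $L$. The local dimension $\operatorname{ldim}(P)$ is the least positive integer $d$ such that $P$ has a local realizer $\mathcal{L}$ with $\mu(P,\mathcal{L})=d$. The cover graph of $P$ is the graph on the elements of $P$ in which $x,y$ are adjacent iff one covers the other. A subposet $B$ of $P$ is convex if $y\in B$ whenever $x,z\in B$ and $x<y<z$ in $P$. A block of $P$ is a convex subposet $B$ of $P$ whose cover graph is a block (maximal $2$-connected subgraph) of the cover graph of $P$. -}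

module Defs where

open import Data.Nat as ℕ using (ℕ; _⊔_; _≤_; _<_)
open import Data.Fin as F using (Fin)
open import Data.Fin.Properties using (_≟_)
open import Data.Fin.Subset using (Subset; _∈_; _∉_; _⊆_; ⊤; _-_; Nonempty)
open import Data.Fin.Subset.Properties using (_∈?_)
open import Data.List using (List; length; lookup; filter; map; foldr; allFin)
open import Data.List.Relation.Unary.Unique.Propositional using (Unique)
import Data.List.Membership.Propositional as MemP
import Data.List.Membership.DecPropositional as MemD
open import Data.Product using (Σ; ∃; _×_; _,_)
open import Data.Sum using (_⊎_)
open import Data.Empty using (⊥)
open import Relation.Nullary using (¬_)
open import Relation.Binary.PropositionalEquality using (_≡_; _≢_)
open import Relation.Binary.Structures using (IsPartialOrder)
open import Level using (0ℓ)

record FinPoset : Set₁ where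
  field
    size  : ℕ
    _≼_   : Fin size → Fin size → Set
    isPartialOrder : IsPartialOrder _≡_ _≼_

  _≺_ : Fin size → Fin size → Set
  x ≺ y = (x ≼ y) × (x ≢ y)

  Incomparable : Fin size → Fin size → Set
  Incomparable x y = ¬ (x ≼ y) × ¬ (y ≼ x)

open FinPoset public

-- Subposets are given by a subset S of the ground set (induced order).
-- Everything below is relative to (P , S); the whole poset is (P , ⊤).

module _ (P : FinPoset) where
  private
    n = size P
    E = Fin n

  Before : List E → E → E → Set
  Before l x y = Σ (Fin (length l)) λ i → Σ (Fin (length l)) λ j →
                   (i F.< j) × (lookup l i ≡ x) × (lookup l j ≡ y)

  -- A partial linear extension of the subposet P|S: a linear extension of
  -- a subposet of P|S, i.e. a repetition-free list of elements of S in which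
  -- every P-relation between its elements is respected.
  record PLE (S : Subset n) : Set where
    constructor mkPLE
    field
      elems    : List E
      unique   : Unique elems
      inside   : ∀ x → x MemP.∈ elems → x ∈ S
      extends  : ∀ x y → _≺_ P x y → x MemP.∈ elems → y MemP.∈ elems →
                 Before elems x y
  open PLE public

  μ : {S : Subset n} → E → List (PLE S) → ℕ
  μ u ℒ = length (filter (λ L → MemD._∈?_ (_≟_ {n}) u (elems L)) ℒ)

  μmax : (S : Subset n) → List (PLE S) → ℕ
  μmax S ℒ = foldr _⊔_ 0 (map (λ u → μ u ℒ) (filter (_∈? S) (allFin n)))

  IsLocalRealizer : (S : Subset n) → List (PLE S) → Set
  IsLocalRealizer S ℒ =
    (∀ x y → x ∈ S → y ∈ S → _≺_ P x y →
       Σ (PLE S) λ L → (L MemP.∈ ℒ) × Before (elems L) x y)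
    × (∀ x y → x ∈ S → y ∈ S → Incomparable P x y →
       Σ (PLE S) λ L → (L MemP.∈ ℒ) × Before (elems L) y x)

  HasRealizerOfMult : (S : Subset n) → ℕ → Set
  HasRealizerOfMult S d =
    Σ (List (PLE S)) λ ℒ → IsLocalRealizer S ℒ × (μmax S ℒ ≡ d)

  HasLdim : (S : Subset n) → ℕ → Set
  HasLdim S d = (1 ≤ d) × HasRealizerOfMult S d
              × (∀ d′ → 1 ≤ d′ → d′ < d → ¬ HasRealizerOfMult S d′)

  Covers : Subset n → E → E → Set
  Covers S x y = x ∈ S × y ∈ S × _≺_ P x y ×
                 (∀ z → z ∈ S → _≺_ P x z → _≺_ P z y → ⊥)

  CoverEdge : Subset n → E → E → Set
  CoverEdge S x y = Covers S x y ⊎ Covers S y x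

  Convex : Subset n → Set
  Convex S = ∀ x y z → x ∈ S → z ∈ S → _≺_ P x y → _≺_ P y z → y ∈ S

module _ {n : ℕ} (Adj : Fin n → Fin n → Set) where

  data Walk (T : Subset n) : Fin n → Fin n → Set where
    stop : ∀ {x} → x ∈ T → Walk T x x
    step : ∀ {x z y} → x ∈ T → Adj x z → Walk T z y → Walk T x y

  Connected : Subset n → Set
  Connected T = ∀ x y → x ∈ T → y ∈ T → Walk T x y

  -- nonempty, connected, and without a cut vertex
  -- (the usual notion of 2-connectedness used for blocks, so K₁ and K₂ count)
  TwoConnected : Subset n → Set
  TwoConnected T = Nonempty T × Connected T × (∀ v → v ∈ T → Connected (T - v))

  IsGraphBlock : Subset n → Set
  IsGraphBlock T = TwoConnected T × (∀ T′ → T ⊆ T′ → TwoConnected T′ → T′ ⊆ T)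

IsPosetBlock : (P : FinPoset) → Subset (size P) → Set
IsPosetBlock P B =
  Convex P B
  × (∀ x y → x ∈ B → y ∈ B → (CoverEdge P B x y → CoverEdge P ⊤ x y)
                            × (CoverEdge P ⊤ x y → CoverEdge P B x y))
  × IsGraphBlock (CoverEdge P ⊤) B

{-# OPTIONS --safe #-}
module Submission where

-- Hang a copy of the poset of depth k below every minimal element of a standard example with a
-- greatest element added; this is the poset Elt n (suc k), where n is the order of the standard
-- example. Its blocks are the standard examples with a top, that is, copies of Elt n 1.
--
-- ldim ≤ k + 2: two linear extensions visiting the children of every node in opposite orders
-- realize everything except that cap i should precede sub i e, which one further ple per child
-- achieves; an element lies in at most k of those.
--
-- ldim ≥ k + 2: suppose that all multiplicities are at most k + 1. At each node a ple puts cap i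
-- before some sub i e for at most one child i. Fix an element y. If n is large, one can descend
-- from the root, each time to a child i that is not served in this way by any ple containing y or
-- one of the caps chosen before. The element x reached is incomparable to the k chosen caps, and
-- the ples placing it above them are distinct and avoid y. With the two ples that order x and y
-- in both ways this makes k + 2 ples containing x.

open import Defs
open import Data.Bool using (true)
open import Data.Empty using (⊥)
open import Data.Fin as F using (Fin; zero; suc)
open import Data.Fin.Properties as Fin using (_≟_)
open import Data.Fin.Subset using (Subset; ⊤; ⁅_⁆; _-_) renaming (_∈_ to _∈ˢ_; _∉_ to _∉ˢ_)
open import Data.Fin.Subset.Properties using (_∈?_; ∈⊤; p─q⊆p; x∈p∧x≢y⇒x∈p-y)
open import Data.List
  using (List; []; _∷_; _++_; [_]; length; lookup; filter; map; concatMap; allFin; tabulate; foldr)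
open import Data.List.Membership.Propositional using (_∈_; _∉_)
import Data.List.Membership.DecPropositional as MemD
open import Data.List.Membership.Propositional.Properties
open import Data.List.Properties
  using (length-++; length-filter; length-tabulate; map-tabulate; tabulate-lookup)
open import Data.List.Relation.Unary.All as All using (All; []; _∷_)
import Data.List.Relation.Unary.All.Properties as All
open import Data.List.Relation.Unary.AllPairs as AllPairs using (AllPairs; []; _∷_)
import Data.List.Relation.Unary.AllPairs.Properties as AllPairs
open import Data.List.Relation.Unary.Any as Any using (Any; here; there)
import Data.List.Relation.Unary.Any.Properties as Any
open import Data.List.Relation.Unary.Unique.Propositional using (Unique)
open import Data.List.Relation.Unary.Unique.Propositional.Properties as Unique using (allFin⁺)
open import Data.Nat using (ℕ; zero; suc; _+_; _*_; _≤_; _<_; z≤n; s≤s; _⊔_)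
import Data.Nat.Properties as ℕ
open import Data.Product using (Σ; ∃; _×_; _,_; proj₁; proj₂)
open import Data.Sum as Sum using (_⊎_; inj₁; inj₂; [_,_]′)
open import Data.Vec as Vec using (_∷_; here; there)
import Data.Vec.Properties as Vec
open import Function using (_∘_; id)
open import Relation.Binary.Definitions using (tri<; tri≈; tri>)
open import Relation.Binary.PropositionalEquality
  using (_≡_; _≢_; refl; sym; trans; cong; subst; subst₂; isEquivalence)
open import Relation.Binary.Structures using (IsPartialOrder)
open import Relation.Nullary
  using (¬_; Dec; yes; no; does; ¬?; _×-dec_; contradiction; decidable-stable; ¬¬-excluded-middle)
open import Relation.Nullary.Decidable using (map′; dec-true)
open import Relation.Unary using (Decidable)

private
  variable
    A B : Set
    n k : ℕ

-- Order of occurrence in lists.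

-- Inductive counterpart of `Before`, suited to recursion on lists; `earlier⇒before` translates
-- back.
data Earlier {A : Set} : List A → A → A → Set where
  here  : ∀ {x y xs} → y ∈ xs → Earlier (x ∷ xs) x y
  there : ∀ {x y z xs} → Earlier xs x y → Earlier (z ∷ xs) x y

earlier-++ : ∀ {xs ys : List A} {x y} → x ∈ xs → y ∈ ys → Earlier (xs ++ ys) x y
earlier-++ {xs = _ ∷ xs} (here refl) y∈ = here (∈-++⁺ʳ xs y∈)
earlier-++ (there x∈) y∈ = there (earlier-++ x∈ y∈)

earlier-++⁺ˡ : ∀ {xs ys : List A} {x y} → Earlier xs x y → Earlier (xs ++ ys) x y
earlier-++⁺ˡ (here y∈) = here (∈-++⁺ˡ y∈)
earlier-++⁺ˡ (there e) = there (earlier-++⁺ˡ e)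

earlier-++⁺ʳ : ∀ xs {ys : List A} {x y} → Earlier ys x y → Earlier (xs ++ ys) x y
earlier-++⁺ʳ []       e = e
earlier-++⁺ʳ (_ ∷ xs) e = there (earlier-++⁺ʳ xs e)

earlier-map : ∀ (f : A → B) {xs x y} → Earlier xs x y → Earlier (map f xs) (f x) (f y)
earlier-map f (here y∈) = here (∈-map⁺ f y∈)
earlier-map f (there e) = there (earlier-map f e)

earlier-concatMap : ∀ (f : A → List B) {is i j x y} → Earlier is i j →
  x ∈ f i → y ∈ f j → Earlier (concatMap f is) x y
earlier-concatMap f (here j∈) x∈ y∈ =
  earlier-++ x∈ (∈-concatMap⁺ f (Any.map (λ { refl → y∈ }) j∈))
earlier-concatMap f (there {z = z} e) x∈ y∈ = earlier-++⁺ʳ (f z) (earlier-concatMap f e x∈ y∈)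

earlier-within : ∀ (f : A → List B) {is i x y} → i ∈ is →
  Earlier (f i) x y → Earlier (concatMap f is) x y
earlier-within f (here refl) e = earlier-++⁺ˡ e
earlier-within f (there {x = z} i∈) e = earlier-++⁺ʳ (f z) (earlier-within f i∈ e)

earlier-total : ∀ {xs : List A} {x y} → x ∈ xs → y ∈ xs → x ≢ y → Earlier xs x y ⊎ Earlier xs y x
earlier-total (here refl) (here refl) x≢y = contradiction refl x≢y
earlier-total (here refl) (there y∈)  _   = inj₁ (here y∈)
earlier-total (there x∈)  (here refl) _   = inj₂ (here x∈)
earlier-total (there x∈)  (there y∈)  x≢y = Sum.map there there (earlier-total x∈ y∈ x≢y)

allPairs-earlier : ∀ {R : A → A → Set} {xs x y} → AllPairs R xs → Earlier xs x y → R x y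
allPairs-earlier (px ∷ _)  (here y∈) = All.lookup px y∈
allPairs-earlier (_ ∷ pxs) (there e) = allPairs-earlier pxs e

earlier-tabulate : ∀ (f : Fin n → A) {i j} → i F.< j → Earlier (tabulate f) (f i) (f j)
earlier-tabulate f {zero}  {suc j} _         = here (∈-tabulate⁺ j)
earlier-tabulate f {suc i} {suc j} (s≤s i<j) = there (earlier-tabulate (f ∘ suc) i<j)

allPairs-concatMap : ∀ {R : B → B → Set} (f : A → List B) {is} → Unique is →
  (∀ i → AllPairs R (f i)) → (∀ {i j x y} → i ≢ j → x ∈ f i → y ∈ f j → R x y) →
  AllPairs R (concatMap f is)
allPairs-concatMap f is! within across =
  AllPairs.concat⁺ (All.map⁺ (All.universal within _))
    (AllPairs.map⁺ (AllPairs.map (λ i≢j → All.tabulate λ x∈ → All.tabulate (across i≢j x∈)) is!))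

all-concatMap : ∀ {P : B → Set} (f : A → List B) is → (∀ i → All P (f i)) → All P (concatMap f is)
all-concatMap f is ps = All.concat⁺ (All.map⁺ (All.universal ps is))

all-map : ∀ {P : B → Set} (f : A → B) xs → (∀ x → P (f x)) → All P (map f xs)
all-map f xs ps = All.map⁺ (All.universal ps xs)

-- Repetition-free lists and the pigeonhole principle.

lookup-injective : ∀ {xs : List A} → Unique xs → ∀ i j → lookup xs i ≡ lookup xs j → i ≡ j
lookup-injective (x∉ ∷ _)  zero    zero    _  = refl
lookup-injective (x∉ ∷ _)  zero    (suc j) eq = contradiction eq (All.lookup x∉ (∈-lookup j))
lookup-injective (x∉ ∷ _)  (suc i) zero    eq = contradiction (sym eq) (All.lookup x∉ (∈-lookup i))
lookup-injective (_ ∷ xs!) (suc i) (suc j) eq = cong suc (lookup-injective xs! i j eq)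

-- Sending each entry of `xs` to its position in `ys` is injective because `xs` has no repetitions.
unique-⊆⇒length≤ : ∀ {xs ys : List A} → Unique xs → (∀ {x} → x ∈ xs → x ∈ ys) →
  length xs ≤ length ys
unique-⊆⇒length≤ {xs = xs} {ys} xs! xs⊆ys = Fin.injective⇒≤ position-injective
  where
  position : Fin (length xs) → Fin (length ys)
  position i = Any.index (xs⊆ys (∈-lookup i))
  position-injective : ∀ {i j} → position i ≡ position j → i ≡ j
  position-injective {i} {j} eq = lookup-injective xs! i j
    (trans (Any.lookup-index (xs⊆ys (∈-lookup i)))
      (trans (cong (lookup ys) eq) (sym (Any.lookup-index (xs⊆ys (∈-lookup j))))))

-- Otherwise the repetition-free list `allFin n` would be contained in the shorter list `is`.
fresh : (is : List (Fin n)) → length is < n → ∃ λ i → i ∉ is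
fresh {n} is short with Fin.any? (λ i → ¬? (Any.any? (i ≟_) is))
... | yes found = found
... | no  none  = contradiction (subst (_≤ length is) (length-tabulate {n = n} id) n≤) (ℕ.<⇒≱ short)
  where
  n≤ : length (allFin n) ≤ length is
  n≤ = unique-⊆⇒length≤ (allFin⁺ n) λ {i} _ →
    decidable-stable (Any.any? (i ≟_) is) λ i∉ → none (i , i∉)

-- Bounding the number of list entries with a property.

-- `keep` spends one unit of the budget whether or not `P x` holds, so upper bounds on
-- multiplicities can be built without deciding membership.
data AtMost {A : Set} (P : A → Set) : ℕ → List A → Set where
  []   : ∀ {c} → AtMost P c []
  skip : ∀ {c x xs} → ¬ P x → AtMost P c xs → AtMost P c (x ∷ xs)
  keep : ∀ {c x xs} → AtMost P c xs → AtMost P (suc c) (x ∷ xs)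

module _ {P : A → Set} where

  atMost-++ : ∀ {c d xs ys} → AtMost P c xs → AtMost P d ys → AtMost P (c + d) (xs ++ ys)
  atMost-++ {zero}  []          q = q
  atMost-++ {suc c} []          q = weaken (atMost-++ {c} [] q)
    where
    weaken : ∀ {c xs} → AtMost P c xs → AtMost P (suc c) xs
    weaken []          = []
    weaken (skip ¬p q) = skip ¬p (weaken q)
    weaken (keep q)    = keep (weaken q)
  atMost-++         (skip ¬p p) q = skip ¬p (atMost-++ p q)
  atMost-++         (keep p)    q = keep (atMost-++ p q)

  none⇒atMost : ∀ {c xs} → All (λ x → ¬ P x) xs → AtMost P c xs
  none⇒atMost []        = []
  none⇒atMost (¬p ∷ ps) = skip ¬p (none⇒atMost ps)

  atMost-filter : ∀ {c xs} (P? : Decidable P) → AtMost P c xs → length (filter P? xs) ≤ c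
  atMost-filter P? [] = z≤n
  atMost-filter P? (skip {x = x} ¬p p) with P? x
  ... | yes px = contradiction px ¬p
  ... | no  _  = atMost-filter P? p
  atMost-filter P? (keep {x = x} p) with P? x
  ... | yes _ = s≤s (atMost-filter P? p)
  ... | no  _ = ℕ.m≤n⇒m≤1+n (atMost-filter P? p)

atMost-map : ∀ {P : A → Set} {Q : B → Set} (f : B → A) → (∀ {x} → P (f x) → Q x) →
  ∀ {c xs} → AtMost Q c xs → AtMost P c (map f xs)
atMost-map f P⇒Q []          = []
atMost-map f P⇒Q (skip ¬q p) = skip (¬q ∘ P⇒Q) (atMost-map f P⇒Q p)
atMost-map f P⇒Q (keep p)    = keep (atMost-map f P⇒Q p)

-- Only the segment `f i` can contribute, and it occurs at most once since `is` has no repetitions.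
atMost-concatMap : ∀ {P : A → Set} (f : Fin n → List A) {c} i {is} → Unique is →
  (∀ {j} → j ≢ i → All (λ x → ¬ P x) (f j)) → AtMost P c (f i) → AtMost P c (concatMap f is)
atMost-concatMap f i [] others p = []
atMost-concatMap {P = P} f {c} i {j ∷ is} (j∉ ∷ is!) others p with j ≟ i
... | no  j≢i = atMost-++ {c = 0} (none⇒atMost (others j≢i)) (atMost-concatMap f i is! others p)
... | yes refl = subst (λ c → AtMost P c _) (ℕ.+-identityʳ c) (atMost-++ p
      (none⇒atMost (All.concat⁺ (All.map⁺ (All.map (λ j≢i → others (j≢i ∘ sym)) j∉)))))

-- The tree of standard examples and its order.

-- The minimal elements of the standard example have no constructor of their own: the `i`-th is the
-- greatest element of the copy `sub i`, and `cap i` is the one maximal element of the standard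
-- example not above it.
data Elt (n : ℕ) : ℕ → Set where
  point : Elt n 0
  apex  : Elt n (suc k)
  cap   : Fin n → Elt n (suc k)
  sub   : Fin n → Elt n k → Elt n (suc k)

data _⊑_ {n} : Elt n k → Elt n k → Set where
  point⊑point : point ⊑ point
  apex⊑apex   : apex {k = k} ⊑ apex
  sub⊑apex    : ∀ {i} {e : Elt n k} → sub i e ⊑ apex
  cap⊑apex    : ∀ {i} → cap {k = k} i ⊑ apex
  cap⊑cap     : ∀ {i} → cap {k = k} i ⊑ cap i
  sub⊑cap     : ∀ {i j} {e : Elt n k} → i ≢ j → sub i e ⊑ cap j
  sub⊑sub     : ∀ {i} {e e′ : Elt n k} → e ⊑ e′ → sub i e ⊑ sub i e′

⊑-refl : ∀ {x : Elt n k} → x ⊑ x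
⊑-refl {x = point}   = point⊑point
⊑-refl {x = apex}    = apex⊑apex
⊑-refl {x = cap i}   = cap⊑cap
⊑-refl {x = sub i e} = sub⊑sub ⊑-refl

⊑-trans : ∀ {x y z : Elt n k} → x ⊑ y → y ⊑ z → x ⊑ z
⊑-trans point⊑point  q            = q
⊑-trans apex⊑apex    q            = q
⊑-trans sub⊑apex     apex⊑apex    = sub⊑apex
⊑-trans cap⊑apex     apex⊑apex    = cap⊑apex
⊑-trans cap⊑cap      q            = q
⊑-trans (sub⊑cap ne) cap⊑cap      = sub⊑cap ne
⊑-trans (sub⊑cap ne) cap⊑apex     = sub⊑apex
⊑-trans (sub⊑sub p)  sub⊑apex     = sub⊑apex
⊑-trans (sub⊑sub p)  (sub⊑cap ne) = sub⊑cap ne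
⊑-trans (sub⊑sub p)  (sub⊑sub q)  = sub⊑sub (⊑-trans p q)

⊑-antisym : ∀ {x y : Elt n k} → x ⊑ y → y ⊑ x → x ≡ y
⊑-antisym point⊑point _           = refl
⊑-antisym apex⊑apex   _           = refl
⊑-antisym cap⊑cap     _           = refl
⊑-antisym (sub⊑sub p) (sub⊑sub q) = cong (sub _) (⊑-antisym p q)

-- An explicit local realizer.

-- Since `⊑` is reflexive, the condition excludes repetitions along with inversions.
LinExt : List (Elt n k) → Set
LinExt = AllPairs λ x y → ¬ (y ⊑ x)

descending : ∀ n → List (Fin n)
descending n = tabulate F.opposite

allFin-or-descending : ∀ {i j : Fin n} → i ≢ j → Earlier (allFin n) i j ⊎ Earlier (descending n) i j
allFin-or-descending {n} {i} {j} i≢j with Fin.<-cmp i j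
... | tri< i<j _ _ = inj₁ (earlier-tabulate id i<j)
... | tri≈ _ i≡j _ = contradiction i≡j i≢j
... | tri> _ _ j<i = inj₂ (subst₂ (Earlier (descending n))
      (Fin.opposite-involutive i) (Fin.opposite-involutive j)
      (earlier-tabulate F.opposite (opposite-< j<i)))
  where
  opposite-< : ∀ {i j : Fin n} → i F.< j → F.opposite j F.< F.opposite i
  opposite-< {i} {j} i<j = subst₂ _<_ (sym (Fin.opposite-prop j)) (sym (Fin.opposite-prop i))
    (ℕ.∸-monoʳ-< (s≤s i<j) (Fin.toℕ<n j))

module _ {n : ℕ} where

  subs : List (Fin n) → List (Elt n k) → List (Elt n (suc k))
  subs is es = concatMap (λ i → map (sub i) es) is

  -- All copies come before all caps, so no choice of `is` puts `cap i` before an element of copy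
  -- `i`; that is left to `partials`.
  ext : List (Fin n) → ∀ k → List (Elt n k)
  ext is zero    = [ point ]
  ext is (suc k) = subs is (ext is k) ++ map cap is ++ [ apex ]

  -- The lists of `branch k i` contain only `cap i` and elements of copy `i`. Different branches of
  -- a node are therefore disjoint, and multiplicities grow with the depth but not with `n`.
  partials : ∀ k → List (List (Elt n k))
  branch   : ∀ k → Fin n → List (List (Elt n (suc k)))
  partials zero    = []
  partials (suc k) = concatMap (branch k) (allFin n)

  branch k i = (cap i ∷ map (sub i) (ext (allFin n) k)) ∷ map (map (sub i)) (partials k)

  realizer : ∀ k → List (List (Elt n k))
  realizer k = ext (allFin n) k ∷ ext (descending n) k ∷ partials k

  ∈-subs : ∀ {is es i} {e : Elt n k} → i ∈ is → e ∈ es → sub i e ∈ subs is es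
  ∈-subs i∈ e∈ = ∈-concatMap⁺ (λ i → map (sub i) _) (Any.map (λ { refl → ∈-map⁺ (sub _) e∈ }) i∈)

  ∈-descending : ∀ i → i ∈ (descending n)
  ∈-descending i = subst (_∈ descending n) (Fin.opposite-involutive i) (∈-tabulate⁺ (F.opposite i))

  ∈-ext : ∀ {is} → (∀ i → i ∈ is) → ∀ (x : Elt n k) → x ∈ ext is k
  ∈-ext           all point     = here refl
  ∈-ext {is = is} all apex      = ∈-++⁺ʳ (subs is _) (∈-++⁺ʳ (map cap is) (here refl))
  ∈-ext {is = is} all (cap i)   = ∈-++⁺ʳ (subs is _) (∈-++⁺ˡ (∈-map⁺ cap (all i)))
  ∈-ext           all (sub i e) = ∈-++⁺ˡ (∈-subs (all i) (∈-ext all e))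

  map-sub-linExt : ∀ i {es : List (Elt n k)} → LinExt es → LinExt (map (sub i) es)
  map-sub-linExt i es! = AllPairs.map⁺ (AllPairs.map (λ { ≰ (sub⊑sub p) → ≰ p }) es!)

  subs-linExt : ∀ {is} {es : List (Elt n k)} → Unique is → LinExt es → LinExt (subs is es)
  subs-linExt is! es! = allPairs-concatMap (λ i → map (sub i) _) is!
    (λ i → map-sub-linExt i es!) λ i≢j x∈ y∈ → across i≢j (∈-map⁻ (sub _) x∈) (∈-map⁻ (sub _) y∈)
    where
    across : ∀ {i j x y} {es : List (Elt n k)} → i ≢ j → (∃ λ e → e ∈ es × x ≡ sub i e) →
      (∃ λ e → e ∈ es × y ≡ sub j e) → ¬ (y ⊑ x)
    across i≢j (_ , _ , refl) (_ , _ , refl) (sub⊑sub _) = i≢j refl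

  caps-linExt : ∀ {is : List (Fin n)} → Unique is → LinExt (map (cap {k = k}) is)
  caps-linExt is! = AllPairs.map⁺ (AllPairs.map (λ { i≢i cap⊑cap → i≢i refl }) is!)

  subs-below : ∀ is es {ys : List (Elt n (suc k))} → (∀ {i e} → All (λ y → ¬ (y ⊑ sub i e)) ys) →
    All (λ x → All (λ y → ¬ (y ⊑ x)) ys) (subs is es)
  subs-below is es below = all-concatMap _ is λ i → all-map (sub i) es λ _ → below

  descending-unique : Unique (descending n)
  descending-unique = Unique.tabulate⁺ λ {i} {j} eq →
    trans (sym (Fin.opposite-involutive i)) (trans (cong F.opposite eq) (Fin.opposite-involutive j))

  ext-linExt : ∀ {is} → Unique is → ∀ k → LinExt (ext is k)
  ext-linExt      is! zero    = [] ∷ []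
  ext-linExt {is} is! (suc k) = AllPairs.++⁺ (subs-linExt is! (ext-linExt is! k))
    (AllPairs.++⁺ (caps-linExt is!) ([] ∷ []) (all-map cap is λ _ → (λ ()) ∷ []))
    (subs-below is (ext is k) (All.++⁺ (all-map cap is λ _ ()) ((λ ()) ∷ [])))

  realizer-linExt : ∀ k → All LinExt (realizer k)
  realizer-linExt k = ext-linExt (allFin⁺ n) k ∷ ext-linExt descending-unique k ∷ partials-linExt k
    where
    partials-linExt : ∀ k → All LinExt (partials k)
    partials-linExt zero    = []
    partials-linExt (suc k) = all-concatMap (branch k) (allFin n) λ i →
      (all-map (sub i) (ext (allFin n) k) (λ { _ (sub⊑cap i≢i) → i≢i refl })
        ∷ map-sub-linExt i (ext-linExt (allFin⁺ n) k))
        ∷ All.map⁺ (All.map (map-sub-linExt i) (partials-linExt k))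

  cap-earlier : ∀ {is i j} → Earlier is i j → Earlier (ext is (suc k)) (cap i) (cap j)
  cap-earlier {is = is} lt = earlier-++⁺ʳ (subs is _) (earlier-++⁺ˡ (earlier-map cap lt))

  sub-earlier : ∀ {is i j} → (∀ i → i ∈ is) → Earlier is i j → ∀ (e e′ : Elt n k) →
    Earlier (ext is (suc k)) (sub i e) (sub j e′)
  sub-earlier all lt e e′ = earlier-++⁺ˡ
    (earlier-concatMap (λ i → map (sub i) _) lt (∈-map⁺ _ (∈-ext all e)) (∈-map⁺ _ (∈-ext all e′)))

  ext-sub : ∀ {is} i {e e′ : Elt n k} → i ∈ is → Earlier (ext is k) e e′ →
    Earlier (ext is (suc k)) (sub i e) (sub i e′)
  ext-sub i i∈ lt = earlier-++⁺ˡ (earlier-within (λ i → map (sub i) _) i∈ (earlier-map (sub i) lt))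

  -- The hypothesis covers both requirements on a local realizer at once: `x` strictly below `y`,
  -- and `x` incomparable to `y`.
  realizes : ∀ (x y : Elt n k) → ¬ (y ⊑ x) → Any (λ l → Earlier l x y) (realizer k)
  realizes point     point      y⋢x = contradiction point⊑point y⋢x
  realizes apex      apex       y⋢x = contradiction apex⊑apex y⋢x
  realizes apex      (cap j)    y⋢x = contradiction cap⊑apex y⋢x
  realizes apex      (sub j e)  y⋢x = contradiction sub⊑apex y⋢x
  realizes (cap i)   apex       y⋢x =
    here (earlier-++⁺ʳ (subs (allFin n) _) (earlier-++ (∈-map⁺ cap (∈-allFin i)) (here refl)))
  realizes (cap i)   (cap j)    y⋢x with i ≟ j
  ... | yes refl = contradiction cap⊑cap y⋢x
  ... | no  i≢j with allFin-or-descending i≢j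
  ...   | inj₁ lt = here (cap-earlier lt)
  ...   | inj₂ lt = there (here (cap-earlier lt))
  realizes (cap i)   (sub j e)  y⋢x with j ≟ i
  ... | no  j≢i  = contradiction (sub⊑cap j≢i) y⋢x
  -- Here `cap i` must precede an element of its own copy, which only the first list of branch `i`
  -- achieves.
  ... | yes refl = there (there (Any.concatMap⁺ (branch _)
      (Any.map (λ { refl → here (here (∈-map⁺ (sub i) (∈-ext ∈-allFin e))) }) (∈-allFin i))))
  realizes (sub i e) apex       y⋢x =
    here (earlier-++ (∈-subs (∈-allFin i) (∈-ext ∈-allFin e))
      (∈-++⁺ʳ (map cap (allFin n)) (here refl)))
  realizes (sub i e) (cap j)    y⋢x =
    here (earlier-++ (∈-subs (∈-allFin i) (∈-ext ∈-allFin e)) (∈-++⁺ˡ (∈-map⁺ cap (∈-allFin j))))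
  realizes (sub i e) (sub j e′) y⋢x with i ≟ j
  realizes (sub i e) (sub j e′) y⋢x | no i≢j with allFin-or-descending i≢j
  ... | inj₁ lt = here (sub-earlier ∈-allFin lt e e′)
  ... | inj₂ lt = there (here (sub-earlier ∈-descending lt e e′))
  realizes (sub i e) (sub j e′) y⋢x | yes refl with realizes e e′ (y⋢x ∘ sub⊑sub)
  ... | here lt          = here (ext-sub i (∈-allFin i) lt)
  ... | there (here lt)  = there (here (ext-sub i (∈-descending i) lt))
  ... | there (there lt) = there (there (Any.concatMap⁺ (branch _)
      (Any.map (λ { refl → there (Any.map⁺ (Any.map (earlier-map (sub i)) lt)) }) (∈-allFin i))))

  ∈-map-sub : ∀ {i j es} {e : Elt n k} → sub i e ∈ map (sub j) es → i ≡ j × e ∈ es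
  ∈-map-sub x∈ with ∈-map⁻ (sub _) x∈
  ... | _ , e∈ , refl = refl , e∈

  apex-∉ : ∀ {i} {es : List (Elt n k)} → apex ∉ map (sub i) es
  apex-∉ x∈ with ∈-map⁻ (sub _) x∈
  ... | _ , _ , ()

  cap-∉ : ∀ {i j} {es : List (Elt n k)} → cap i ∉ map (sub j) es
  cap-∉ x∈ with ∈-map⁻ (sub _) x∈
  ... | _ , _ , ()

  -- Two comes from the lists `ext`. Among `partials`, an element of copy `i` meets only branch `i`:
  -- at most once in its first list, and in the others at most as often as the count for one level
  -- less.
  multiplicity : ∀ (x : Elt n k) → AtMost (x ∈_) (2 + k) (realizer k)
  multiplicity {k} x = keep (keep (in-partials k x))
    where
    in-partials : ∀ k (x : Elt n k) → AtMost (x ∈_) k (partials k)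
    in-partials zero    x         = []
    in-partials (suc k) apex      = none⇒atMost (all-concatMap (branch k) (allFin n) λ i →
      (λ { (there x∈) → apex-∉ x∈ }) ∷ all-map (map (sub i)) (partials k) λ _ → apex-∉)
    in-partials (suc k) (cap i)   = atMost-concatMap (branch k) i (allFin⁺ n)
      (λ j≢i → (λ { (here refl) → j≢i refl ; (there x∈) → cap-∉ x∈ })
               ∷ all-map (map (sub _)) (partials k) λ _ → cap-∉)
      (keep (none⇒atMost (all-map (map (sub i)) (partials k) λ _ → cap-∉)))
    in-partials (suc k) (sub i e) = atMost-concatMap (branch k) i (allFin⁺ n)
      (λ j≢i → (λ { (there x∈) → j≢i (sym (proj₁ (∈-map-sub x∈))) })
               ∷ all-map (map (sub _)) (partials k) λ _ x∈ → j≢i (sym (proj₁ (∈-map-sub x∈))))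
      (keep (atMost-map (map (sub i)) (proj₂ ∘ ∈-map-sub) (in-partials k e)))

-- Multiplicities and the order inside a ple.

length-filter-map : ∀ {P : B → Set} (P? : Decidable P) (f : A → B) xs →
  length (filter (P? ∘ f) xs) ≡ length (filter P? (map f xs))
length-filter-map P? f [] = refl
length-filter-map P? f (x ∷ xs) with P? (f x)
... | yes _ = cong suc (length-filter-map P? f xs)
... | no  _ = length-filter-map P? f xs

max-bound : ∀ (f : A → ℕ) {c} xs → (∀ {x} → x ∈ xs → f x ≤ c) → foldr _⊔_ 0 (map f xs) ≤ c
max-bound f []       _     = z≤n
max-bound f (x ∷ xs) bound = ℕ.⊔-lub (bound (here refl)) (max-bound f xs (bound ∘ there))

≤-max : ∀ (f : A → ℕ) {x xs} → x ∈ xs → f x ≤ foldr _⊔_ 0 (map f xs)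
≤-max f (here refl)         = ℕ.m≤m⊔n _ _
≤-max f (there {x = y} x∈) = ℕ.≤-trans (≤-max f x∈) (ℕ.m≤n⊔m (f y) _)

module _ (P : FinPoset) where
  before-trans : ∀ {l x y z} → Unique l → Before P l x y → Before P l y z → Before P l x z
  before-trans l! (i , j , i<j , xi , yj) (j′ , m , j′<m , yj′ , zm) =
    i , m , Fin.<-trans i<j (subst (F._< m) j′≡j j′<m) , xi , zm
    where
    j′≡j : j′ ≡ j
    j′≡j = lookup-injective l! j′ j (trans yj′ (sym yj))

  before-irrefl : ∀ {l x} → Unique l → ¬ Before P l x x
  before-irrefl l! (i , j , i<j , xi , xj) =
    Fin.<-irrefl (lookup-injective l! i j (trans xi (sym xj))) i<j

  before⇒∈ˡ : ∀ {l x y} → Before P l x y → x ∈ l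
  before⇒∈ˡ (i , _ , _ , refl , _) = ∈-lookup i

  before⇒∈ʳ : ∀ {l x y} → Before P l x y → y ∈ l
  before⇒∈ʳ (_ , j , _ , _ , refl) = ∈-lookup j

  earlier⇒before : ∀ {l x y} → Earlier l x y → Before P l x y
  earlier⇒before (here y∈) = zero , suc (Any.index y∈) , s≤s z≤n , refl , sym (Any.lookup-index y∈)
  earlier⇒before (there e) with earlier⇒before e
  ... | i , j , i<j , xi , yj = suc i , suc j , s≤s i<j , xi , yj

  module _ {S : Subset (size P)} where

    occurs? : ∀ x → Decidable λ (L : PLE P S) → x ∈ elems L
    occurs? x L = MemD._∈?_ _≟_ x (elems L)

    μ≤μmax : ∀ (ℒ : List (PLE P S)) {x} → x ∈ˢ S → μ P x ℒ ≤ μmax P S ℒ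
    μ≤μmax ℒ {x} x∈S = ≤-max (λ u → μ P u ℒ) (∈-filter⁺ (_∈? S) (∈-allFin x) x∈S)

    μmax≤ : ∀ (ℒ : List (PLE P S)) {c} → (∀ {x} → x ∈ˢ S → μ P x ℒ ≤ c) → μmax P S ℒ ≤ c
    μmax≤ ℒ bound = max-bound (λ u → μ P u ℒ) _
      λ x∈ → bound (proj₂ (∈-filter⁻ (_∈? S) {xs = allFin _} x∈))

    singleton-ldim : ∀ {x} → x ∈ˢ S → (∀ {y} → y ∈ˢ S → y ≡ x) → HasLdim P S 1
    singleton-ldim {x} x∈S only =
      s≤s z≤n , (L ∷ [] , (<-realized , ∥-realized) , μmax≡1) , λ { _ (s≤s _) (s≤s ()) }
      where
      L : PLE P S
      L = record { elems = x ∷ [] ; unique = [] ∷ []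
                 ; inside = λ { _ (here refl) → x∈S }
                 ; extends = λ { _ _ (_ , x≢x) (here refl) (here refl) → contradiction refl x≢x } }
      <-realized : ∀ a b → a ∈ˢ S → b ∈ˢ S → _≺_ P a b →
        Σ (PLE P S) λ L′ → (L′ ∈ L ∷ []) × Before P (elems L′) a b
      <-realized a b a∈ b∈ (_ , a≢b) = contradiction (trans (only a∈) (sym (only b∈))) a≢b
      ∥-realized : ∀ a b → a ∈ˢ S → b ∈ˢ S → Incomparable P a b →
        Σ (PLE P S) λ L′ → (L′ ∈ L ∷ []) × Before P (elems L′) b a
      ∥-realized a b a∈ b∈ (a⋠b , _) =
        contradiction (reflexive (trans (only a∈) (sym (only b∈)))) a⋠b
        where open IsPartialOrder (isPartialOrder P) using (reflexive)
      1≤μ : 1 ≤ μ P x (L ∷ [])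
      1≤μ = ∈-length (∈-filter⁺ (occurs? x) {xs = L ∷ []} (here refl) (here refl))
      μmax≡1 : μmax P S (L ∷ []) ≡ 1
      μmax≡1 = ℕ.≤-antisym (μmax≤ (L ∷ []) λ {y} _ → length-filter (occurs? y) (L ∷ []))
        (ℕ.≤-trans 1≤μ (μ≤μmax (L ∷ []) x∈S))

-- Order embeddings of the tree.

-- Bounds are proved along order embeddings, so that the whole tree, the copies met in the descent
-- and the blocks are treated alike inside one fixed poset.
record Embedding (n k : ℕ) (P : FinPoset) : Set where
  open FinPoset P using () renaming (_≼_ to _≼ₚ_)
  field
    at        : Elt n k → Fin (size P)
    monotone  : ∀ {x y} → x ⊑ y → at x ≼ₚ at y
    reflects  : ∀ {x y} → at x ≼ₚ at y → x ⊑ y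

  injective : ∀ {x y} → at x ≡ at y → x ≡ y
  injective eq = ⊑-antisym (reflects (reflexive eq)) (reflects (reflexive (sym eq)))
    where open IsPartialOrder (isPartialOrder P) using (reflexive)

  strict : ∀ {x y} → x ⊑ y → x ≢ y → _≺_ P (at x) (at y)
  strict x⊑y x≢y = monotone x⊑y , x≢y ∘ injective

  incomparable : ∀ {x y} → ¬ (x ⊑ y) → ¬ (y ⊑ x) → Incomparable P (at x) (at y)
  incomparable x⋢y y⋢x = x⋢y ∘ reflects , y⋢x ∘ reflects

open Embedding

subEmbedding : ∀ {P} → Embedding n (suc k) P → Fin n → Embedding n k P
subEmbedding g i = record
  { at       = λ e → at g (sub i e)
  ; monotone = monotone g ∘ sub⊑sub
  ; reflects = λ le → unsub (reflects g le)
  }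
  where
  unsub : ∀ {i} {e e′ : Elt n k} → sub i e ⊑ sub i e′ → e ⊑ e′
  unsub (sub⊑sub p) = p

-- The lower bound on multiplicities.

root : ∀ k → Elt n k
root zero    = point
root (suc k) = apex

-- At depth `k`, with multiplicities at most `suc k`, the descent forbids at most `suc k` positions
-- for the starting element and `suc k` more for each of the `k` chosen caps. The `2` provides one
-- excluded and one free child.
width : ℕ → ℕ
width k = 2 + suc k * suc k

module LocalRealizer (P : FinPoset) {S : Subset (size P)} (ℒ : List (PLE P S))
                     (isRealizer : IsLocalRealizer P S ℒ) where

  -- Ples are referred to by their position in ℒ, since μ counts repeated list entries.
  Position : Set
  Position = Fin (length ℒ)

  ple : Position → List (Fin (size P))
  ple L = elems (lookup ℒ L)

  _<[_]_ : Fin (size P) → Position → Fin (size P) → Set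
  x <[ L ] y = Before P (ple L) x y

  occurrences : Fin (size P) → List Position
  occurrences x = filter (occurs? P x ∘ lookup ℒ) (allFin _)

  length-occurrences : ∀ x → length (occurrences x) ≡ μ P x ℒ
  length-occurrences x = trans (length-filter-map (occurs? P x) (lookup ℒ) (allFin _))
    (cong (length ∘ filter (occurs? P x)) (trans (map-tabulate id (lookup ℒ)) (tabulate-lookup ℒ)))

  ∈-occurrences : ∀ {x L} → x ∈ ple L → L ∈ occurrences x
  ∈-occurrences x∈ = ∈-filter⁺ (occurs? P _ ∘ lookup ℒ) (∈-allFin _) x∈

  <[]-irrefl : ∀ L {x} → ¬ (x <[ L ] x)
  <[]-irrefl L = before-irrefl P (unique (lookup ℒ L))

  <[]-trans : ∀ L {x y z} → x <[ L ] y → y <[ L ] z → x <[ L ] z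
  <[]-trans L = before-trans P (unique (lookup ℒ L))

  reversed-at : ∀ {x y} → x ∈ˢ S → y ∈ˢ S → Incomparable P x y → ∃ λ L → y <[ L ] x
  reversed-at x∈ y∈ x∥y with proj₂ isRealizer _ _ x∈ y∈ x∥y
  ... | L , L∈ , b = Any.index L∈ , subst (λ L → Before P (elems L) _ _) (Any.lookup-index L∈) b

  -- The ples ordering `x` and `y` in the two ways are distinct, and both contain `y`, so neither is
  -- among `Ls`.
  two-more : ∀ {x y} Ls → x ∈ˢ S → y ∈ˢ S → Incomparable P x y → Unique Ls →
    All (λ L → x ∈ ple L × L ∉ occurrences y) Ls → 2 + length Ls ≤ μ P x ℒ
  two-more {x} {y} Ls x∈S y∈S (x⋠y , y⋠x) Ls! avoid
    with reversed-at x∈S y∈S (x⋠y , y⋠x) | reversed-at y∈S x∈S (y⋠x , x⋠y)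
  ... | L , y<x | L′ , x<y = subst (2 + length Ls ≤_) (length-occurrences x)
    (unique-⊆⇒length≤ ((L≢L′ ∷ new (before⇒∈ˡ P y<x)) ∷ new (before⇒∈ʳ P x<y) ∷ Ls!) occurs)
    where
    L≢L′ : L ≢ L′
    L≢L′ refl = <[]-irrefl L (<[]-trans L y<x x<y)
    new : ∀ {M} → y ∈ ple M → All (M ≢_) Ls
    new y∈ = All.map (λ { (_ , M∉) refl → M∉ (∈-occurrences y∈) }) avoid
    occurs : ∀ {M} → M ∈ L ∷ L′ ∷ Ls → M ∈ occurrences x
    occurs (here refl)         = ∈-occurrences (before⇒∈ʳ P y<x)
    occurs (there (here refl)) = ∈-occurrences (before⇒∈ˡ P x<y)
    occurs (there (there M∈))  = ∈-occurrences (proj₁ (All.lookup avoid M∈))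

  Serves : Embedding n (suc k) P → Position → Fin n → Set
  Serves g L i = ∃ λ e → at g (cap i) <[ L ] at g (sub i e)

  -- If L served i and j ≠ i, then cap i < sub i e < cap j < sub j e′ < cap i in L.
  serves-one : ∀ (g : Embedding n (suc k) P) {L i j} → Serves g L i → Serves g L j → i ≡ j
  serves-one g {L} {i} {j} (e , b) (e′ , b′) with i ≟ j
  ... | yes i≡j = i≡j
  ... | no  i≢j = contradiction
        (<[]-trans L (<[]-trans L b  (below i≢j (before⇒∈ʳ P b) (before⇒∈ˡ P b′)))
                     (<[]-trans L b′ (below (i≢j ∘ sym) (before⇒∈ʳ P b′) (before⇒∈ˡ P b))))
        (<[]-irrefl L)
    where
    below : ∀ {i j e} → i ≢ j → at g (sub i e) ∈ ple L → at g (cap j) ∈ ple L →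
      at g (sub i e) <[ L ] at g (cap j)
    below i≢j = extends (lookup ℒ L) _ _ (strict g (sub⊑cap i≢j) λ ())

  -- By `serves-one` each position adds at most one child. Excluded middle enters only under a
  -- double negation, which suffices because the descent ends in a contradiction.
  served : ∀ (g : Embedding n (suc k) P) Fs →
    ¬ ¬ ∃ λ is → length is ≤ length Fs × (∀ {L i} → L ∈ Fs → Serves g L i → i ∈ is)
  served g []       none = none ([] , z≤n , λ ())
  served g (L ∷ Fs) none =
    served g Fs λ (is , le , all) → ¬¬-excluded-middle {A = ∃ (Serves g L)} λ where
      (yes (i , s)) → none (i ∷ is , s≤s le , λ
        { (here refl) s′ → here (serves-one g s′ s) ; (there L∈) s′ → there (all L∈ s′) })
      (no ¬s) → none (is , ℕ.m≤n⇒m≤1+n le , λ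
        { (here refl) s′ → contradiction (_ , s′) ¬s ; (there L∈) s′ → all L∈ s′ })

  -- At most `length Fs` children are served and `c` rules out one more, so `2 + length Fs` children
  -- leave one free.
  choose-child : ∀ (g : Embedding n (suc k) P) Fs c → 2 + length Fs ≤ n →
    ¬ ¬ ∃ λ i → i ≢ c × (∀ {L} → L ∈ Fs → ¬ Serves g L i)
  choose-child g Fs c room none = served g Fs λ (is , le , all) →
    let i , i∉ = fresh (c ∷ is) (ℕ.≤-trans (s≤s (s≤s le)) room)
    in none (i , i∉ ∘ here , λ L∈ s → i∉ (there (all L∈ s)))

  -- The positions collected by a descent to `x`, one for each of the `k` levels.
  Avoiding : Embedding n k P → List Position → Elt n k → Set
  Avoiding {k = k} g Fs x = Σ (List Position) λ Ls → length Ls ≡ k × Unique Ls ×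
    All (λ L → at g x ∈ ple L × L ∉ Fs) Ls

  -- Some position puts `cap i` before `sub i x`. It serves `i`, hence is not in `Fs`; it contains
  -- `cap i`, hence is new, since `Ls` avoids all occurrences of that cap.
  avoiding-step : ∀ (g : Embedding n (suc k) P) Fs {i} → (∀ x → at g x ∈ˢ S) →
    (∀ {L} → L ∈ Fs → ¬ Serves g L i) → ∀ {x} →
    Avoiding (subEmbedding g i) (Fs ++ occurrences (at g (cap i))) x → Avoiding g Fs (sub i x)
  avoiding-step g Fs {i} inS unserved {x} (Ls , len , Ls! , avoid)
    with reversed-at (inS (sub i x)) (inS (cap i))
           (incomparable g (λ { (sub⊑cap i≢i) → i≢i refl }) (λ ()))
  ... | L , b =
    L ∷ Ls , cong suc len ,
    All.map (λ { (_ , M∉) refl → M∉ (∈-++⁺ʳ Fs (∈-occurrences (before⇒∈ˡ P b))) }) avoid ∷ Ls! ,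
    (before⇒∈ʳ P b , λ L∈ → unserved L∈ (x , b)) ∷ All.map (λ (x∈ , M∉) → x∈ , M∉ ∘ ∈-++⁺ˡ) avoid

  module _ (D : ℕ) (bound : ∀ {x} → x ∈ˢ S → μ P x ℒ ≤ D) where

    occurrences≤ : ∀ {x} → x ∈ˢ S → length (occurrences x) ≤ D
    occurrences≤ x∈S = ℕ.≤-trans (ℕ.≤-reflexive (length-occurrences _)) (bound x∈S)

    -- Each level pays for the occurrences of its cap with one of the `suc k` summands `D`.
    enlarge : ∀ {m} k Fs {x} → x ∈ˢ S → 2 + length Fs + suc k * D ≤ m →
      2 + length (Fs ++ occurrences x) + k * D ≤ m
    enlarge {m} k Fs {x} x∈S room = begin
      2 + length (Fs ++ occurrences x) + k * D
        ≡⟨ cong (λ l → 2 + l + k * D) (length-++ Fs) ⟩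
      2 + (length Fs + length (occurrences x)) + k * D
        ≤⟨ ℕ.+-monoˡ-≤ (k * D) (ℕ.+-monoʳ-≤ (2 + length Fs) (occurrences≤ x∈S)) ⟩
      2 + length Fs + D + k * D
        ≡⟨ ℕ.+-assoc (2 + length Fs) D (k * D) ⟩
      2 + length Fs + suc k * D
        ≤⟨ room ⟩
      m ∎
      where open ℕ.≤-Reasoning

    -- Induction on the depth, the occurrences of each chosen cap joining the forbidden positions.
    -- `descend-off` also records that the first child differs from `c`; at the root this makes `x`
    -- and `y` incomparable.
    descend : ∀ k (g : Embedding n k P) → (∀ x → at g x ∈ˢ S) → ∀ Fs → Fin n →
      2 + length Fs + k * D ≤ n → ¬ ¬ ∃ λ x → Avoiding g Fs x
    descend-off : ∀ k (g : Embedding n (suc k) P) → (∀ x → at g x ∈ˢ S) → ∀ Fs c →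
      2 + length Fs + suc k * D ≤ n → ¬ ¬ ∃ λ i → i ≢ c × ∃ λ x → Avoiding g Fs (sub i x)

    descend zero    g inS Fs c room none = none (point , [] , refl , [] , [])
    descend (suc k) g inS Fs c room none =
      descend-off k g inS Fs c room λ (i , _ , x , av) → none (sub i x , av)

    descend-off k g inS Fs c room none =
      choose-child g Fs c (ℕ.≤-trans (ℕ.m≤m+n _ _) room) λ (i , i≢c , unserved) →
      descend k (subEmbedding g i) (inS ∘ sub i) (Fs ++ occurrences (at g (cap i))) c
        (enlarge k Fs (inS (cap i)) room) λ (x , av) →
      none (i , i≢c , x , avoiding-step g Fs inS unserved av)

  -- With the occurrences of `y` forbidden from the start, the descent yields `suc k` positions
  -- avoiding `y`; `two-more` raises this to `3 + k` positions containing the element reached.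
  large-multiplicity : ∀ k → width (suc k) ≤ n → (g : Embedding n (suc k) P) →
    (∀ x → at g x ∈ˢ S) → ¬ (∀ {x} → x ∈ˢ S → μ P x ℒ ≤ 2 + k)
  large-multiplicity {suc n} k wide g inS bound =
    descend-off (2 + k) bound k g inS (occurrences (at g y)) zero
      (ℕ.≤-trans (ℕ.+-monoˡ-≤ _ (ℕ.+-monoʳ-≤ 2 (occurrences≤ (2 + k) bound (inS y)))) wide)
      λ (i , i≢0 , x , Ls , len , Ls! , avoid) →
    ℕ.<⇒≱ (subst (λ m → 2 + m ≤ μ P (at g (sub i x)) ℒ) len
        (two-more Ls (inS (sub i x)) (inS y)
          (incomparable g (λ { (sub⊑sub _) → i≢0 refl }) (λ { (sub⊑sub _) → i≢0 refl })) Ls! avoid))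
      (bound (inS (sub i x)))
    where
    -- Below child zero, which the descent avoids (i≢0), so that x and y are incomparable.
    y : Elt (suc n) (suc k)
    y = sub zero (root k)

-- The local dimension of an embedded tree.

module _ {P : FinPoset} {S : Subset (size P)} (g : Embedding n k P)
         (inS : ∀ x → at g x ∈ˢ S) (onto : ∀ {y} → y ∈ˢ S → ∃ λ x → at g x ≡ y) where
  open IsPartialOrder (isPartialOrder P) using (antisym; reflexive)

  image-ple : {l : List (Elt n k)} → LinExt l → PLE P S
  image-ple {l} l! = record
    { elems   = map (at g) l
    ; unique  = AllPairs.map⁺ (AllPairs.map (λ y⋢x → y⋢x ∘ reflects g ∘ reflexive ∘ sym) l!)
    ; inside  = λ y y∈ → inside′ (∈-map⁻ (at g) y∈)
    ; extends = λ y z y≺z y∈ z∈ → extends′ y≺z (∈-map⁻ (at g) y∈) (∈-map⁻ (at g) z∈)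
    }
    where
    inside′ : ∀ {y} → (∃ λ x → x ∈ l × y ≡ at g x) → y ∈ˢ S
    inside′ (x , _ , refl) = inS x
    extends′ : ∀ {y z} → _≺_ P y z → (∃ λ x → x ∈ l × y ≡ at g x) →
      (∃ λ x → x ∈ l × z ≡ at g x) → Before P (map (at g) l) y z
    extends′ (y≼z , y≢z) (x , x∈ , refl) (x′ , x′∈ , refl)
      with earlier-total x∈ x′∈ (y≢z ∘ cong (at g))
    ... | inj₁ e = earlier⇒before P (earlier-map (at g) e)
    ... | inj₂ e = contradiction (reflects g y≼z) (allPairs-earlier l! e)

  image-ples : {ls : List (List (Elt n k))} → All LinExt ls → List (PLE P S)
  image-ples = All.reduce image-ple

  image-realizes : ∀ {ls x y} (ls! : All LinExt ls) → Any (λ l → Earlier l x y) ls →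
    Σ (PLE P S) λ L → (L ∈ image-ples ls!) × Before P (elems L) (at g x) (at g y)
  image-realizes (l! ∷ _)  (here e)  =
    image-ple l! , here refl , earlier⇒before P (earlier-map (at g) e)
  image-realizes (_ ∷ ls!) (there e) with image-realizes ls! e
  ... | L , L∈ , b = L , there L∈ , b

  image-multiplicity : ∀ {x c ls} (ls! : All LinExt ls) → AtMost (x ∈_) c ls →
    AtMost (λ L → at g x ∈ elems L) c (image-ples ls!)
  image-multiplicity []         []          = []
  image-multiplicity (l! ∷ ls!) (skip x∉ q) =
    skip (x∉ ∘ back ∘ ∈-map⁻ (at g)) (image-multiplicity ls! q)
    where
    back : ∀ {x l} → (∃ λ x′ → x′ ∈ l × at g x ≡ at g x′) → x ∈ l
    back (x′ , x′∈ , eq) = subst (_∈ _) (sym (injective g eq)) x′∈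
  image-multiplicity (_ ∷ ls!)  (keep q)    = keep (image-multiplicity ls! q)

  image-realizer : List (PLE P S)
  image-realizer = image-ples (realizer-linExt k)

  image-isLocalRealizer : IsLocalRealizer P S image-realizer
  image-isLocalRealizer =
    (λ x y x∈ y∈ (x≼y , x≢y) → realize x∈ y∈ (λ y≼x → x≢y (antisym x≼y y≼x))) ,
    (λ x y x∈ y∈ (x⋠y , y⋠x) → realize y∈ x∈ x⋠y)
    where
    realize : ∀ {x y} → x ∈ˢ S → y ∈ˢ S → ¬ (_≼_ P y x) →
      Σ (PLE P S) λ L → (L ∈ image-realizer) × Before P (elems L) x y
    realize x∈ y∈ y⋠x with onto x∈ | onto y∈
    ... | u , refl | v , refl = image-realizes (realizer-linExt k) (realizes u v (y⋠x ∘ monotone g))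

  image-μ≤ : ∀ {y} → y ∈ˢ S → μ P y image-realizer ≤ 2 + k
  image-μ≤ y∈ with onto y∈
  ... | x , refl = atMost-filter (occurs? P (at g x))
    (image-multiplicity (realizer-linExt k) (multiplicity x))

-- `HasLdim` asks for an exact multiplicity: the explicit realizer stays within `3 + k`, and no
-- local realizer stays within `2 + k`. This serves for the whole tree and, with `k` equal to 0, for
-- every block.
image-ldim : ∀ {P} {S : Subset (size P)} → width (suc k) ≤ n → (g : Embedding n (suc k) P) →
  (∀ x → at g x ∈ˢ S) → (∀ {y} → y ∈ˢ S → ∃ λ x → at g x ≡ y) → HasLdim P S (3 + k)
image-ldim {k} {n} {P} {S} wide g inS onto =
  s≤s z≤n ,
  (image-realizer g inS onto , image-isLocalRealizer g inS onto ,
    ℕ.≤-antisym (μmax≤ P (image-realizer g inS onto) (image-μ≤ g inS onto))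
      (ℕ.≰⇒> (too-small _ (image-isLocalRealizer g inS onto)))) ,
  λ { d _ (s≤s d≤) (ℒ , rlz , refl) → too-small ℒ rlz d≤ }
  where
  too-small : ∀ ℒ → IsLocalRealizer P S ℒ → ¬ (μmax P S ℒ ≤ 2 + k)
  too-small ℒ rlz le = LocalRealizer.large-multiplicity P ℒ rlz k wide g inS
    λ x∈ → ℕ.≤-trans (μ≤μmax P ℒ x∈) le

-- Numbering the elements of the tree.

card : ℕ → ℕ → ℕ
card n zero    = 1
card n (suc k) = suc (n + n * card n k)

encode : Elt n k → Fin (card n k)
encode point             = zero
encode apex              = zero
encode (cap i)           = suc (F.join _ _ (inj₁ i))
encode {n = n} (sub i e) = suc (F.join n _ (inj₂ (F.combine i (encode e))))

decode : ∀ n k → Fin (card n k) → Elt n k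
decode n zero    _       = point
decode n (suc k) zero    = apex
decode n (suc k) (suc p) =
  [ cap , (λ (i , q) → sub i (decode n k q)) ∘ F.remQuot (card n k) ]′ (F.splitAt n p)

decode-encode : ∀ (x : Elt n k) → decode n k (encode x) ≡ x
decode-encode point = refl
decode-encode apex  = refl
decode-encode {n} {suc k} (cap i) rewrite Fin.splitAt-join n (n * card n k) (inj₁ i) = refl
decode-encode {n} {suc k} (sub i e)
  rewrite Fin.splitAt-join n (n * card n k) (inj₂ (F.combine i (encode e))) =
  trans (cong (λ (i , q) → sub i (decode n k q)) (Fin.remQuot-combine i (encode e)))
    (cong (sub i) (decode-encode e))

encode-decode : ∀ n k p → encode (decode n k p) ≡ p
encode-decode n zero    zero    = refl
encode-decode n (suc k) zero    = refl
encode-decode n (suc k) (suc p) with F.splitAt n p in eq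
... | inj₁ i = cong suc (trans (cong (F.join n _) (sym eq)) (Fin.join-splitAt n _ p))
... | inj₂ q = cong suc (trans (cong (λ q → F.join n _ (inj₂ q))
        (trans (cong (F.combine (proj₁ (F.remQuot {n} _ q))) (encode-decode n k _))
          (Fin.combine-remQuot {n} _ q)))
        (trans (cong (F.join n _) (sym eq)) (Fin.join-splitAt n _ p)))

tree : ℕ → ℕ → FinPoset
tree n k = record
  { size = card n k
  ; _≼_  = λ p q → decode n k p ⊑ decode n k q
  ; isPartialOrder = record
    { isPreorder = record
      { isEquivalence = isEquivalence
      ; reflexive     = λ { refl → ⊑-refl }
      ; trans         = ⊑-trans
      }
    ; antisym = λ p≼q q≼p → trans (sym (encode-decode n k _))
        (trans (cong encode (⊑-antisym p≼q q≼p)) (encode-decode n k _))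
    }
  }

encodeEmbedding : ∀ n k → Embedding n k (tree n k)
encodeEmbedding n k = record
  { at       = encode
  ; monotone = λ {x} {y} → subst₂ _⊑_ (sym (decode-encode x)) (sym (decode-encode y))
  ; reflects = λ {x} {y} → subst₂ _⊑_ (decode-encode x) (decode-encode y)
  }

some? : ∀ {P : Elt n k → Set} → Decidable P → Dec (∃ P)
some? {P = P} P? = map′ (λ (p , Pp) → decode _ _ p , Pp)
  (λ (x , Px) → encode x , subst P (sym (decode-encode x)) Px) (Fin.any? (P? ∘ decode _ _))

⊑-root : ∀ (x : Elt n k) → x ⊑ root k
⊑-root point     = point⊑point
⊑-root apex      = apex⊑apex
⊑-root (cap i)   = cap⊑apex
⊑-root (sub i e) = sub⊑apex

root⊑ : ∀ {x : Elt n k} → root k ⊑ x → x ≡ root k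
root⊑ {x = x} r⊑x = ⊑-antisym (⊑-root x) r⊑x

root? : Decidable (_≡ root {n} k)
root? point     = yes refl
root? apex      = yes refl
root? (cap i)   = no λ ()
root? (sub i e) = no λ ()

-- Subsets and walks.

x∉p-x : ∀ {x : Fin n} (p : Subset n) → x ∉ˢ p - x
x∉p-x {x = zero}  (_ ∷ p) ()
x∉p-x {x = suc x} (_ ∷ p) (there x∈) = x∉p-x p x∈

module _ {N : ℕ} where

  comprehension : ∀ {Q : Fin N → Set} → Decidable Q →
    ∃ λ U → ∀ {x} → (x ∈ˢ U → Q x) × (Q x → x ∈ˢ U)
  comprehension Q? = Vec.tabulate (does ∘ Q?) , λ {x} →
    (λ x∈ → does-true (Q? x) (trans (sym (Vec.lookup∘tabulate (does ∘ Q?) x)) (Vec.[]=⇒lookup x∈))) ,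
    (λ Qx → Vec.lookup⇒[]= x _ (trans (Vec.lookup∘tabulate (does ∘ Q?) x) (dec-true (Q? x) Qx)))
    where
    does-true : ∀ {Q : Set} (Q? : Dec Q) → does Q? ≡ true → Q
    does-true (yes q) _ = q

  module _ {Adj : Fin N → Fin N → Set} where

    walk-trans : ∀ {T x y z} → Walk Adj T x y → Walk Adj T y z → Walk Adj T x z
    walk-trans (stop _)      w′ = w′
    walk-trans (step x∈ e w) w′ = step x∈ e (walk-trans w w′)

    walk-start : ∀ {T x y} → Walk Adj T x y → x ∈ˢ T
    walk-start (stop x∈)     = x∈
    walk-start (step x∈ _ _) = x∈

    walk-sym : (∀ {x y} → Adj x y → Adj y x) → ∀ {T x y} → Walk Adj T x y → Walk Adj T y x
    walk-sym adj-sym (stop x∈)     = stop x∈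
    walk-sym adj-sym (step x∈ e w) =
      walk-trans (walk-sym adj-sym w) (step (walk-start w) (adj-sym e) (stop x∈))

    hub-connected : (∀ {x y} → Adj x y → Adj y x) → ∀ {T} h →
      (∀ {x} → x ∈ˢ T → Walk Adj T x h) → Connected Adj T
    hub-connected adj-sym h to-hub x y x∈ y∈ = walk-trans (to-hub x∈) (walk-sym adj-sym (to-hub y∈))

-- Blocks of the tree.

module _ {n : ℕ} (P : FinPoset) where
  open FinPoset P using () renaming (_≼_ to _≼ₚ_)
  private
    Vertex = Fin (size P)

  Edge : Vertex → Vertex → Set
  Edge = CoverEdge P ⊤

  edge-sym : ∀ {x y} → Edge x y → Edge y x
  edge-sym = Sum.swap

  -- By `isolated`, cover edges leave the copy only at its root, which therefore separates it from
  -- the rest. By `convex`, covers between elements of the copy can be checked in `Elt`.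
  record Subtree (k : ℕ) : Set where
    field
      emb      : Embedding n k P
      convex   : ∀ {u v z} → at emb u ≼ₚ z → z ≼ₚ at emb v → ∃ λ w → z ≡ at emb w
      isolated : ∀ {u z} → u ≢ root k → Edge (at emb u) z → ∃ λ w → z ≡ at emb w

  open Subtree

  -- A cover leading up out of copy `i` from a non-root element would have the root of the copy
  -- strictly in between. A cover leading down stays in the image of `t` by `isolated t`, and there
  -- only elements of copy `i` lie below those of copy `i`.
  subtree : Subtree (suc k) → Fin n → Subtree k
  subtree {k} t i = record { emb = subEmbedding (emb t) i ; convex = convex′ ; isolated = isolated′ }
    where
    f : Elt n (suc k) → Vertex
    f = at (emb t)
    convex′ : ∀ {u v z} → f (sub i u) ≼ₚ z → z ≼ₚ f (sub i v) → ∃ λ w → z ≡ f (sub i w)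
    convex′ u≼z z≼v with convex t u≼z z≼v
    ... | w , refl with reflects (emb t) z≼v
    ...   | sub⊑sub _ = _ , refl
    no-cover : ∀ {u y} → u ≢ root k → sub i (root k) ⊑ y → sub i (root k) ≢ y →
      ¬ Covers P ⊤ (f (sub i u)) (f y)
    no-cover {u} u≢root r⊑y r≢y (_ , _ , _ , minimal) = minimal _ ∈⊤
      (strict (emb t) (sub⊑sub (⊑-root u)) λ { refl → u≢root refl }) (strict (emb t) r⊑y r≢y)
    up : ∀ {u w} → u ≢ root k → sub i u ⊑ w → Covers P ⊤ (f (sub i u)) (f w) →
      ∃ λ v → f w ≡ f (sub i v)
    up u≢root sub⊑apex      c = contradiction c (no-cover u≢root sub⊑apex λ ())
    up u≢root (sub⊑cap i≢j) c = contradiction c (no-cover u≢root (sub⊑cap i≢j) λ ())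
    up u≢root (sub⊑sub _)   c = _ , refl
    isolated′ : ∀ {u z} → u ≢ root k → Edge (f (sub i u)) z → ∃ λ w → z ≡ f (sub i w)
    isolated′ u≢root e with isolated t (λ ()) e
    isolated′ u≢root (inj₁ c@(_ , _ , (u≼z , _) , _)) | w , refl = up u≢root (reflects (emb t) u≼z) c
    isolated′ u≢root (inj₂ (_ , _ , (z≼u , _) , _))   | w , refl with reflects (emb t) z≼u
    ... | sub⊑sub _ = _ , refl

  -- A walk could leave the copy only through its root, which `T` does not contain.
  trapped : ∀ (t : Subtree k) {T x y} → (∀ {z} → z ∈ˢ T → z ≢ at (emb t) (root k)) →
    (∃ λ u → x ≡ at (emb t) u) → Walk Edge T x y → ∃ λ v → y ≡ at (emb t) v
  trapped t avoids x∈t        (stop _)      = x∈t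
  trapped t avoids (u , refl) (step x∈ e w) =
    trapped t avoids (isolated t (λ { refl → avoids x∈ refl }) e) w

  -- Representing each copy by its root leaves the standard example with a top at the uppermost
  -- node.
  blockEmbedding : Embedding n (suc k) P → Embedding n 1 P
  blockEmbedding {k} g = record
    { at = at g ∘ inc ; monotone = monotone g ∘ inc-mono ; reflects = inc-reflects ∘ reflects g }
    where
    inc : Elt n 1 → Elt n (suc k)
    inc apex      = apex
    inc (cap i)   = cap i
    inc (sub i _) = sub i (root k)
    inc-mono : ∀ {x y} → x ⊑ y → inc x ⊑ inc y
    inc-mono apex⊑apex     = apex⊑apex
    inc-mono sub⊑apex      = sub⊑apex
    inc-mono cap⊑apex      = cap⊑apex
    inc-mono cap⊑cap       = cap⊑cap
    inc-mono (sub⊑cap i≢j) = sub⊑cap i≢j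
    inc-mono (sub⊑sub _)   = ⊑-refl
    inc-reflects : ∀ {x y} → inc x ⊑ inc y → x ⊑ y
    inc-reflects {apex}        {apex}        apex⊑apex     = apex⊑apex
    inc-reflects {cap i}       {apex}        cap⊑apex      = cap⊑apex
    inc-reflects {cap i}       {cap j}       cap⊑cap       = cap⊑cap
    inc-reflects {sub i point} {apex}        sub⊑apex      = sub⊑apex
    inc-reflects {sub i point} {cap j}       (sub⊑cap i≢j) = sub⊑cap i≢j
    inc-reflects {sub i point} {sub j point} (sub⊑sub _)   = sub⊑sub point⊑point

  InBlock : Subtree (suc k) → Vertex → Set
  InBlock t x = ∃ λ u → x ≡ at (blockEmbedding (emb t)) u

  -- If T contains a non-root element of the subtree at child i, then T lies in that subtree, since
  -- its root separates it from the rest of the cover graph.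
  in-some-block : ∀ {T} → TwoConnected Edge T → (t : Subtree (suc k)) →
    (∀ {x} → x ∈ˢ T → ∃ λ u → x ≡ at (emb t) u) →
    Σ ℕ λ k′ → Σ (Subtree (suc k′)) λ t′ → ∀ {x} → x ∈ˢ T → InBlock t′ x
  in-some-block {k} {T} two@(_ , connected , connected-) t T⊆t
    with Fin.any? (λ i → some? λ e → ¬? (root? e) ×-dec (at (emb t) (sub i e) ∈? T))
  ... | no none = k , t , λ x∈ → in-block x∈ (T⊆t x∈)
    where
    in-block : ∀ {x} → x ∈ˢ T → (∃ λ u → x ≡ at (emb t) u) → InBlock t x
    in-block x∈ (apex , refl)  = apex , refl
    in-block x∈ (cap i , refl) = cap i , refl
    in-block x∈ (sub i e , refl) with root? e
    ... | yes refl   = sub i point , refl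
    ... | no  e≢root = contradiction (i , e , e≢root , x∈) none
  in-some-block {suc k} {T} two@(_ , connected , connected-) t T⊆t | yes (i , e , e≢root , e∈T) =
    in-some-block two t′ T⊆t′
    where
    t′ : Subtree (suc k)
    t′ = subtree t i
    r : Vertex
    r = at (emb t′) apex
    T⊆t′ : ∀ {x} → x ∈ˢ T → ∃ λ u → x ≡ at (emb t′) u
    T⊆t′ {x} x∈ with x ≟ r | r ∈? T
    ... | yes x≡r | _       = apex , x≡r
    ... | no  x≢r | no  r∉T = trapped t′ (λ { z∈ refl → r∉T z∈ }) (e , refl) (connected _ _ e∈T x∈)
    ... | no  x≢r | yes r∈T = trapped t′ (λ { z∈ refl → x∉p-x T z∈ }) (e , refl)
      (connected- r r∈T _ _ (x∈p∧x≢y⇒x∈p-y e∈T (e≢root ∘ injective (emb t′)))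
        (x∈p∧x≢y⇒x∈p-y x∈ x≢r))
  in-some-block {zero} two t T⊆t | yes (i , point , e≢root , _) = contradiction refl e≢root

  module _ (wide : 3 < n) (t : Subtree (suc k)) where
    private
      φ : Elt n 1 → Vertex
      φ = at (blockEmbedding (emb t))
      φ-injective : ∀ {u v} → φ u ≡ φ v → u ≡ v
      φ-injective = injective (blockEmbedding (emb t))

    sub-cap-edge : ∀ {i j} → i ≢ j → Edge (φ (sub i point)) (φ (cap j))
    sub-cap-edge {i} {j} i≢j = inj₁ (∈⊤ , ∈⊤ , strict (emb t) (sub⊑cap i≢j) (λ ()) , λ z _ → between z)
      where
      between : ∀ z → _≺_ P (at (emb t) (sub i (root k))) z → _≺_ P z (at (emb t) (cap j)) → ⊥
      between z (s≼z , s≢z) (z≼c , z≢c) with convex t s≼z z≼c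
      ... | w , refl with reflects (emb t) s≼z | reflects (emb t) z≼c
      ...   | sub⊑sub r⊑ | _       = s≢z (cong (at (emb t) ∘ sub i) (sym (root⊑ r⊑)))
      ...   | sub⊑cap _  | cap⊑cap = z≢c refl

    cap-apex-edge : ∀ {i} → Edge (φ (cap i)) (φ apex)
    cap-apex-edge {i} = inj₁ (∈⊤ , ∈⊤ , strict (emb t) cap⊑apex (λ ()) , λ z _ → between z)
      where
      between : ∀ z → _≺_ P (at (emb t) (cap i)) z → _≺_ P z (at (emb t) apex) → ⊥
      between z (c≼z , c≢z) (z≼a , z≢a) with convex t c≼z z≼a
      ... | w , refl with reflects (emb t) c≼z
      ...   | cap⊑cap  = c≢z refl
      ...   | cap⊑apex = z≢a refl

    other : ∀ i j → ∃ λ l → l ≢ i × l ≢ j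
    other i j with fresh (i ∷ j ∷ []) (ℕ.≤-trans (s≤s (s≤s (s≤s z≤n))) wide)
    ... | l , l∉ = l , (λ eq → l∉ (here eq)) , (λ eq → l∉ (there (here eq)))

    -- Formulated for any `T` inside the block, so as to apply both to the whole block and after the
    -- deletion of a vertex. A minimal element reaches the hub through a cap still in `T`.
    block-connected : ∀ {T} → (∀ {x} → x ∈ˢ T → InBlock t x) → ∀ h →
      (∀ i → φ (sub i point) ∈ˢ T → ∃ λ j → j ≢ i × φ (cap j) ∈ˢ T) →
      (∀ j → φ (cap j) ∈ˢ T → Walk Edge T (φ (cap j)) h) →
      (φ apex ∈ˢ T → Walk Edge T (φ apex) h) → Connected Edge T
    block-connected T⊆block h sub-cap cap-hub apex-hub =
      hub-connected edge-sym h λ x∈ → to-hub x∈ (T⊆block x∈)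
      where
      to-hub : ∀ {x} → x ∈ˢ _ → InBlock t x → Walk Edge _ x h
      to-hub x∈ (apex , refl)  = apex-hub x∈
      to-hub x∈ (cap j , refl) = cap-hub j x∈
      to-hub x∈ (sub i point , refl) with sub-cap i x∈
      ... | j , j≢i , c∈ = step x∈ (sub-cap-edge (λ i≡j → j≢i (sym i≡j))) (cap-hub j c∈)

    -- As long as the apex is present it is the hub. If a cap or a minimal element of index `m` is
    -- deleted, the caps of the other indices still link all minimal elements to the apex.
    block-twoConnected : ∀ {U} → (∀ {x} → (x ∈ˢ U → InBlock t x) × (InBlock t x → x ∈ˢ U)) →
      TwoConnected Edge U
    block-twoConnected {U} U≐block =
      (φ apex , φ∈ apex) , connected , λ v v∈ → connected- (proj₁ U≐block v∈)
      where
      φ∈ : ∀ u → φ u ∈ˢ U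
      φ∈ u = proj₂ U≐block (u , refl)
      connected : Connected Edge U
      connected = block-connected (proj₁ U≐block) (φ apex)
        (λ i _ → let j , j≢i , _ = other i i in j , j≢i , φ∈ (cap j))
        (λ j c∈ → step c∈ cap-apex-edge (stop (φ∈ apex))) stop
      U-v⊆block : ∀ {v x} → x ∈ˢ U - v → InBlock t x
      U-v⊆block {v} = proj₁ U≐block ∘ p─q⊆p U ⁅ v ⁆
      survives : ∀ {u v} → u ≢ v → φ u ∈ˢ U - φ v
      survives u≢v = x∈p∧x≢y⇒x∈p-y (φ∈ _) (u≢v ∘ φ-injective)
      hub-apex : ∀ {v} m → (∀ j → j ≢ m → cap j ≢ v) → apex ≢ v → Connected Edge (U - φ v)
      hub-apex {v} m cap≢ apex≢ = block-connected (U-v⊆block {φ v}) (φ apex)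
        (λ i _ → let j , j≢i , j≢m = other i m in j , j≢i , survives (cap≢ j j≢m))
        (λ j c∈ → step c∈ cap-apex-edge (stop (survives apex≢))) stop
      c₀ : Fin n
      c₀ = F.fromℕ< wide
      connected- : ∀ {v} → InBlock t v → Connected Edge (U - v)
      connected- (cap m , refl)       = hub-apex m (λ { j j≢m refl → j≢m refl }) λ ()
      connected- (sub m point , refl) = hub-apex {sub m point} m (λ _ _ ()) λ ()
      -- Without the apex a fixed cap is the hub; `cap j` reaches it through some `sub l point`
      -- below both.
      connected- (apex , refl)        = block-connected (U-v⊆block {φ apex}) (φ (cap c₀))
        (λ i _ → let j , j≢i , _ = other i i in j , j≢i , survives λ ())
        (λ j _ → let l , l≢j , l≢c₀ = other j c₀ in
          step (survives λ ()) (edge-sym (sub-cap-edge l≢j))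
            (step (survives {sub l point} λ ()) (sub-cap-edge l≢c₀) (stop (survives λ ()))))
        (λ a∈ → contradiction a∈ (x∉p-x {x = φ apex} U))

-- `B` lies in the standard example with a top at some node. As the subset `U` this is 2-connected,
-- so maximality of `B` forces equality.
tree-block-ldim : ∀ {n k} → width (suc k) ≤ n → ∀ B → IsPosetBlock (tree n (suc k)) B →
  HasLdim (tree n (suc k)) B 3
tree-block-ldim {n} {k} wide B (_ , _ , two , maximal) =
  from-block (in-some-block P two whole λ {x} _ → onto x)
  where
  P : FinPoset
  P = tree n (suc k)
  onto : ∀ x → ∃ λ u → x ≡ encode u
  onto x = decode n (suc k) x , sym (encode-decode n (suc k) x)
  whole : Subtree P (suc k)
  whole = record
    { emb = encodeEmbedding n (suc k) ; convex = λ _ _ → onto _ ; isolated = λ _ _ → onto _ }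
  width1≤n : width 1 ≤ n
  width1≤n = ℕ.≤-trans (ℕ.+-monoʳ-≤ 2 (ℕ.*-mono-≤ (ℕ.m≤m+n 2 k) (ℕ.m≤m+n 2 k))) wide
  from-block : (Σ ℕ λ k′ → Σ (Subtree P (suc k′)) λ t → ∀ {x} → x ∈ˢ B → InBlock P t x) →
    HasLdim P B 3
  from-block (_ , t , B⊆block) = image-ldim width1≤n (blockEmbedding P (Subtree.emb t))
    (λ u → maximal U (proj₂ U≐block ∘ B⊆block)
      (block-twoConnected P (ℕ.≤-trans (ℕ.m≤m+n 4 2) width1≤n) t U≐block)
      (proj₂ U≐block (u , refl)))
    (λ y∈ → let u , eq = B⊆block y∈ in u , sym eq)
    where
    block : ∃ λ U → ∀ {x} → (x ∈ˢ U → InBlock P t x) × (InBlock P t x → x ∈ˢ U)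
    block = comprehension λ x → some? λ u → x ≟ at (blockEmbedding P (Subtree.emb t)) u
    U : Subset (size P)
    U = proj₁ block
    U≐block : ∀ {x} → (x ∈ˢ U → InBlock P t x) × (InBlock P t x → x ∈ˢ U)
    U≐block = proj₂ block

-- Antichains for dimensions 1 and 2, and the theorem.

antichain : ℕ → FinPoset
antichain n = record
  { size = n ; _≼_ = _≡_
  ; isPartialOrder = record
    { isPreorder = record { isEquivalence = isEquivalence ; reflexive = id ; trans = trans }
    ; antisym = λ eq _ → eq } }

-- The cover graph of an antichain has no edges, so every walk is trivial.
antichain-connected : ∀ {T} → Connected (CoverEdge (antichain n) ⊤) T →
  ∀ {x y} → x ∈ˢ T → y ∈ˢ T → x ≡ y
antichain-connected connected x∈ y∈ with connected _ _ x∈ y∈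
... | stop _ = refl
... | step _ (inj₁ (_ , _ , (eq , ne) , _)) _ = contradiction eq ne
... | step _ (inj₂ (_ , _ , (eq , ne) , _)) _ = contradiction eq ne

antichain-block-ldim : ∀ B → IsPosetBlock (antichain n) B → HasLdim (antichain n) B 1
antichain-block-ldim B (_ , _ , ((x , x∈) , connected , _) , _) =
  singleton-ldim (antichain _) x∈ λ y∈ → antichain-connected connected y∈ x∈

antichain₂-ldim : HasLdim (antichain 2) ⊤ 2
antichain₂-ldim =
  s≤s z≤n ,
  (up ∷ down ∷ [] , ((λ { _ _ _ _ (eq , ne) → contradiction eq ne }) , realized) , refl) ,
  -- Already with an empty list of avoiding positions, `two-more` gives two ples containing `zero`.
  λ { d _ (s≤s d≤1) (ℒ , rlz , refl) → ℕ.<⇒≱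
      (LocalRealizer.two-more (antichain 2) ℒ rlz {x = zero} {y = suc zero} []
        ∈⊤ ∈⊤ ((λ ()) , (λ ())) [] [])
      (ℕ.≤-trans (μ≤μmax (antichain 2) ℒ ∈⊤) d≤1) }
  where
  pair : ∀ (x y : Fin 2) → x ≢ y → PLE (antichain 2) ⊤
  pair x y x≢y = record { elems = x ∷ y ∷ [] ; unique = (x≢y ∷ []) ∷ [] ∷ []
    ; inside = λ _ _ → ∈⊤ ; extends = λ { _ _ (eq , ne) → contradiction eq ne } }
  up down : PLE (antichain 2) ⊤
  up   = pair zero (suc zero) λ ()
  down = pair (suc zero) zero λ ()
  realized : ∀ x y → x ∈ˢ ⊤ → y ∈ˢ ⊤ → Incomparable (antichain 2) x y →
    Σ (PLE (antichain 2) ⊤) λ L → (L ∈ up ∷ down ∷ []) × Before (antichain 2) (elems L) y x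
  realized zero       zero       _ _ (x≢x , _) = contradiction refl x≢x
  realized zero       (suc zero) _ _ _         =
    down , there (here refl) , zero , suc zero , s≤s z≤n , refl , refl
  realized (suc zero) zero       _ _ _         =
    up , here refl , zero , suc zero , s≤s z≤n , refl , refl
  realized (suc zero) (suc zero) _ _ (x≢x , _) = contradiction refl x≢x

theorem4 : (d : ℕ) → 1 ≤ d →
    Σ FinPoset λ P → HasLdim P ⊤ d
    × ((B : Subset (size P)) → IsPosetBlock P B →
    Σ ℕ λ k → HasLdim P B k × k ≤ 3)
theorem4 1 _ = antichain 1 ,
  singleton-ldim (antichain 1) {x = zero} ∈⊤ (λ { {zero} _ → refl }) ,
  λ B block → 1 , antichain-block-ldim B block , s≤s z≤n
theorem4 2 _ = antichain 2 , antichain₂-ldim ,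
  λ B block → 1 , antichain-block-ldim B block , s≤s z≤n
-- Depth `suc k` gives local dimension `3 + k`, which is `d`; the branching number `m` is the width
-- demanded by the lower bound.
theorem4 (suc (suc (suc k))) _ = tree m (suc k) ,
  image-ldim ℕ.≤-refl (encodeEmbedding m (suc k)) (λ _ → ∈⊤)
    (λ {y} _ → decode m (suc k) y , encode-decode m (suc k) y) ,
  λ B block → 3 , tree-block-ldim ℕ.≤-refl B block , ℕ.≤-refl
  where
  m : ℕ
  m = width (suc k)
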